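{- For every two integers $a,b$ with $2\le a\le b$, there exists a finite, simple, connected graph $G$ of order $b$ with $\dim_{wt}(G)=a$.
   Context: $d(x,y)$ is the shortest-path distance. A set $W\subseteq V(G)$ is a resolving set if for every two distinct vertices $y,z$ there is $x\in W$ with $d(y,x)\ne d(z,x)$. A set $W$ is a weak total resolving set (WTR-set) if $W$ is resolving and, for every $w\in W$ and every $x\in V(G)\setminus W$, there is $w'\in W\setminus\{w\}$ with $d(x,w')\ne d(w,w')$. $\dim_{wt}(G)$ is the minimum cardinality of a WTR-set. -}

module Defs where

open import Data.Nat.Base using (ℕ; zero; suc; _≤_; z≤n; s≤s)
open import Data.Nat.Properties as ℕ using ()
open import Data.Fin.Base using (Fin)
open import Data.Fin.Properties using (any?; all?; _≟_)
open import Data.Fin.Subset using (Subset; _∈_; _∉_; ⊤; ∣_∣)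
open import Data.Fin.Subset.Properties using (_∈?_; ∈⊤; anySubset?)
open import Data.Product.Base using (∃; ∃-syntax; _×_; _,_; proj₁; proj₂)
open import Level using (0ℓ)
open import Relation.Binary.Core using (Rel)
open import Relation.Binary.Definitions as Binary using (Symmetric)
open import Relation.Binary.PropositionalEquality.Core using (_≡_; _≢_; refl; subst)
open import Relation.Nullary.Decidable
  using (yes; no; map′; ¬?; _×-dec_; _→-dec_)
open import Relation.Nullary.Negation.Core using (¬_; contradiction)
open import Relation.Unary using (Pred; Decidable)

IsLeast : Pred ℕ 0ℓ → ℕ → Set
IsLeast P k = P k × (∀ m → P m → k ≤ m)

least : {P : Pred ℕ 0ℓ} → Decidable P → ∃ P → ∃ (IsLeast P)
least {P} P? (n , pn) = go P P? n pn
  where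
  go : (Q : Pred ℕ 0ℓ) → Decidable Q → ∀ n → Q n → ∃ (IsLeast Q)
  go Q Q? n       qn with Q? 0
  go Q Q? n       qn | yes q0 = 0 , q0 , λ _ _ → z≤n
  go Q Q? zero    qn | no ¬q0 = contradiction qn ¬q0
  go Q Q? (suc n) qn | no ¬q0 with go (λ k → Q (suc k)) (λ k → Q? (suc k)) n qn
  ... | k , qk , min = suc k , qk , λ where
    zero    q0 → contradiction q0 ¬q0
    (suc m) qm → s≤s (min m qm)

-- A simple graph of order n, with vertex set Fin n.
record SimpleGraph (n : ℕ) : Set₁ where
  field
    Adj       : Rel (Fin n) 0ℓ
    adj?      : Binary.Decidable Adj
    symmetric : Symmetric Adj
    loopless  : ∀ {x} → ¬ Adj x x

module _ {n : ℕ} (G : SimpleGraph n) where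
  open SimpleGraph G

  -- Walk x y k: a walk with k edges from x to y.
  data Walk : Fin n → Fin n → ℕ → Set where
    []  : ∀ {x} → Walk x x 0
    _∷_ : ∀ {x y z k} → Adj x y → Walk y z k → Walk x z (suc k)

  walk? : ∀ x y → Decidable (Walk x y)
  walk? x y zero    = map′ (λ { refl → [] }) (λ { [] → refl }) (x ≟ y)
  walk? x y (suc k) =
    map′ (λ { (_ , e , p) → e ∷ p }) (λ { (e ∷ p) → _ , e , p })
         (any? λ z → adj? x z ×-dec walk? z y k)

  Connected : Set
  Connected = ∀ x y → ∃ (Walk x y)

module _ {n : ℕ} (G : SimpleGraph n) (conn : Connected G) where

  -- A walk of least length repeats no vertex, so this is the length of a
  -- shortest path.
  distance : ∀ x y → ∃ (IsLeast (Walk G x y))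
  distance x y = least (walk? G x y) (conn x y)

  d : Fin n → Fin n → ℕ
  d x y = proj₁ (distance x y)

  Resolving : Pred (Subset n) 0ℓ
  Resolving W = ∀ y z → y ≢ z → ∃[ x ] (x ∈ W × d y x ≢ d z x)

  WeakTotalResolving : Pred (Subset n) 0ℓ
  WeakTotalResolving W =
    Resolving W ×
    (∀ w x → w ∈ W → x ∉ W → ∃[ w′ ] (w′ ∈ W × w′ ≢ w × d x w′ ≢ d w w′))

  weakTotalResolving? : Decidable WeakTotalResolving
  weakTotalResolving? W =
    (all? λ y → all? λ z → ¬? (y ≟ z) →-dec
      any? λ x → (x ∈? W) ×-dec ¬? (d y x ℕ.≟ d z x))
    ×-dec
    (all? λ w → all? λ x → (w ∈? W) →-dec (¬? (x ∈? W) →-dec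
      any? λ w′ → (w′ ∈? W) ×-dec (¬? (w′ ≟ w) ×-dec ¬? (d x w′ ℕ.≟ d w w′))))

  d-refl : ∀ x → d x x ≡ 0
  d-refl x = ℕ.n≤0⇒n≡0 (proj₂ (proj₂ (distance x x)) 0 [])

  d≡0⇒≡ : ∀ {x y} → d x y ≡ 0 → x ≡ y
  d≡0⇒≡ {x} {y} eq with subst (Walk G x y) eq (proj₁ (proj₂ (distance x y)))
  ... | [] = refl

  ⊤-weakTotalResolving : WeakTotalResolving ⊤
  ⊤-weakTotalResolving =
    (λ y z y≢z → z , ∈⊤ , λ eq → y≢z (d≡0⇒≡ (subst (d y z ≡_) (d-refl z) eq))) ,
    (λ _ _ _ x∉⊤ → contradiction ∈⊤ x∉⊤)

  WTRCardinality : Pred ℕ 0ℓ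
  WTRCardinality k = ∃[ W ] (WeakTotalResolving W × ∣ W ∣ ≡ k)

  wtrCardinality? : Decidable WTRCardinality
  wtrCardinality? k = anySubset? λ W → weakTotalResolving? W ×-dec (∣ W ∣ ℕ.≟ k)

  weakTotalDimension : ∃ (IsLeast WTRCardinality)
  weakTotalDimension = least wtrCardinality? (∣ ⊤ {n} ∣ , ⊤ , ⊤-weakTotalResolving , refl)

  dim-wt : ℕ
  dim-wt = proj₁ weakTotalDimension

{-# OPTIONS --safe #-}
module Submission where

-- The extremal graph is a lollipop: a clique on a − 1 vertices, extended by a
-- path whose first vertex is adjacent to the whole clique.  Putting the clique
-- on level 0 and the path on levels 1, 2, …, two distinct vertices are
-- adjacent when their levels differ by at most 1, and the distance of distinct
-- vertices of levels i and j is 1 ⊔ ∣ i - j ∣.  The clique vertices together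
-- with the free end of the path form a WTR-set of cardinality a.  Conversely,
-- two clique vertices are at equal distance from every third vertex.  So a
-- WTR-set omitting a clique vertex v forces the clique to be {v}, and it has two
-- elements: one by resolving, another to separate the first from v.  A WTR-set W
-- containing the clique also has an element on the path, as otherwise the first
-- vertex of the path could not be told from a clique vertex w using W ∖ {w}.

open import Defs
open import Data.Bool.Base using (true; false)
open import Data.Fin.Base using (Fin; zero; suc; toℕ; fromℕ<)
open import Data.Fin.Properties
  using (_≟_; all?; ¬∀⟶∃¬; toℕ-injective; toℕ-fromℕ<; toℕ≤pred[n])
open import Data.Fin.Subset
  using (Subset; _∈_; _∉_; _⊆_; ⊤; ⊥; ⁅_⁆; _∪_; ∣_∣)
open import Data.Fin.Subset.Properties
  using (_∈?_; ∉⊥; x∈⁅x⁆; ∣⊥∣≡0; x∈⁅y⁆⇒x≡y; ∣⁅x⁆∣≡1;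
         p⊆q⇒∣p∣≤∣q∣; p⊂q⇒∣p∣<∣q∣; p⊆p∪q; q⊆p∪q)
open import Data.Nat.Base
  using (ℕ; zero; suc; _+_; _∸_; _⊔_; ∣_-_∣; _≤_; _<_; z≤n; s≤s; s≤s⁻¹; z<s; s<s; s<s⁻¹)
open import Data.Nat.Properties as ℕ using ()
open import Data.Product.Base using (∃-syntax; Σ-syntax; _×_; _,_; proj₁; proj₂)
open import Data.Sum.Base as Sum using (_⊎_; inj₁; inj₂)
open import Data.Vec.Base using (_++_; []; _∷_; here; there)
open import Function.Base using (_∘_; case_of_)
open import Relation.Binary.PropositionalEquality
  using (_≡_; _≢_; refl; sym; trans; cong; cong₂; subst)
open import Relation.Nullary.Decidable using (yes; no; ¬?; _×-dec_; _→-dec_; decidable-stable)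
open import Relation.Nullary.Negation.Core using (contradiction)
open import Relation.Unary using (Decidable)

-- Least values and cardinalities of subsets.

IsLeast-unique : ∀ {P m n} → IsLeast P m → IsLeast P n → m ≡ n
IsLeast-unique (pm , m≤) (pn , n≤) = ℕ.≤-antisym (m≤ _ pn) (n≤ _ pm)

d-unique : ∀ {n} (G : SimpleGraph n) (conn : Connected G) {x y k} →
           IsLeast (Walk G x y) k → d G conn x y ≡ k
d-unique G conn = IsLeast-unique (proj₂ (distance G conn _ _))

-- Passing to dim-wt for a variable graph spares the type checker the search for
-- a minimal WTR-set of a concrete one.
least⇒dim-wt : ∀ {n a} →
  Σ[ G ∈ SimpleGraph n ] Σ[ conn ∈ Connected G ] IsLeast (WTRCardinality G conn) a →
  Σ[ G ∈ SimpleGraph n ] Σ[ conn ∈ Connected G ] dim-wt G conn ≡ a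
least⇒dim-wt (G , conn , least-a) =
  G , conn , IsLeast-unique (proj₂ (weakTotalDimension G conn)) least-a

∣p∪q∣≤∣p∣+∣q∣ : ∀ {n} (p q : Subset n) → ∣ p ∪ q ∣ ≤ ∣ p ∣ + ∣ q ∣
∣p∪q∣≤∣p∣+∣q∣ []          []          = z≤n
∣p∪q∣≤∣p∣+∣q∣ (false ∷ p) (false ∷ q) = ∣p∪q∣≤∣p∣+∣q∣ p q
∣p∪q∣≤∣p∣+∣q∣ (false ∷ p) (true  ∷ q) =
  subst (suc ∣ p ∪ q ∣ ≤_) (sym (ℕ.+-suc ∣ p ∣ ∣ q ∣)) (s≤s (∣p∪q∣≤∣p∣+∣q∣ p q))
∣p∪q∣≤∣p∣+∣q∣ (true  ∷ p) (false ∷ q) = s≤s (∣p∪q∣≤∣p∣+∣q∣ p q)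
∣p∪q∣≤∣p∣+∣q∣ (true  ∷ p) (true  ∷ q) =
  s≤s (ℕ.≤-trans (∣p∪q∣≤∣p∣+∣q∣ p q) (ℕ.+-monoʳ-≤ ∣ p ∣ (ℕ.n≤1+n ∣ q ∣)))

∈∧∉⇒≢ : ∀ {n} {p : Subset n} {x y} → x ∈ p → y ∉ p → x ≢ y
∈∧∉⇒≢ {p = p} x∈ y∉ x≡y = y∉ (subst (_∈ p) x≡y x∈)

initial : ∀ m n → Subset (m + n)
initial m n = ⊤ {m} ++ ⊥ {n}

∣initial∣ : ∀ m n → ∣ initial m n ∣ ≡ m
∣initial∣ zero    n = ∣⊥∣≡0 n
∣initial∣ (suc m) n = cong suc (∣initial∣ m n)

<⇒∈initial : ∀ m n {x} → toℕ x < m → x ∈ initial m n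
<⇒∈initial (suc m) n {zero}  _   = here
<⇒∈initial (suc m) n {suc x} x<m = there (<⇒∈initial m n (s<s⁻¹ x<m))

∈initial⇒< : ∀ m n {x} → x ∈ initial m n → toℕ x < m
∈initial⇒< zero    n             x∈         = contradiction x∈ ∉⊥
∈initial⇒< (suc m) n {zero}      _          = z<s
∈initial⇒< (suc m) n {suc x}     (there x∈) = s<s (∈initial⇒< m n x∈)

-- The level `l` lies one step from `i` on the way to `j`. As the levels in use are closed
-- downwards, the bound by `i` or `j` ensures that some vertex has level `l`.
towards : ∀ i j {k} → ∣ i - j ∣ ≡ suc k →
          ∃[ l ] ((l ≤ i ⊎ l ≤ j) × ∣ i - l ∣ ≡ 1 × ∣ l - j ∣ ≡ k)
towards zero    (suc j) refl = 1 , inj₂ (s≤s z≤n) , refl , refl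
towards (suc i) zero    refl = i , inj₁ (ℕ.n≤1+n i) , ∣1+i-i∣≡1 i , ℕ.∣-∣-identityʳ i
  where
  ∣1+i-i∣≡1 : ∀ i → ∣ suc i - i ∣ ≡ 1
  ∣1+i-i∣≡1 zero    = refl
  ∣1+i-i∣≡1 (suc i) = ∣1+i-i∣≡1 i
towards (suc i) (suc j) eq with towards i j eq
... | l , l≤ , il , lj = suc l , Sum.map s≤s s≤s l≤ , il , lj

-- Distances in graphs defined by levels.

module LevelGraph {n : ℕ} (ℓ : Fin n → ℕ)
                  (attained : ∀ x {i} → i ≤ ℓ x → ∃[ z ] ℓ z ≡ i) where

  G : SimpleGraph n
  G = record
    { Adj       = λ x y → x ≢ y × ∣ ℓ x - ℓ y ∣ ≤ 1
    ; adj?      = λ x y → ¬? (x ≟ y) ×-dec (∣ ℓ x - ℓ y ∣ ℕ.≤? 1)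
    ; symmetric = λ {x} {y} (x≢y , δ≤1) →
        x≢y ∘ sym , subst (_≤ 1) (ℕ.∣-∣-comm (ℓ x) (ℓ y)) δ≤1
    ; loopless  = λ (x≢x , _) → x≢x refl
    }

  step : ∀ x y {k} → ∣ ℓ x - ℓ y ∣ ≡ suc k →
         ∃[ z ] (∣ ℓ x - ℓ z ∣ ≡ 1 × ∣ ℓ z - ℓ y ∣ ≡ k)
  step x y eq with towards (ℓ x) (ℓ y) eq
  ... | l , l≤ , xl , ly with Sum.[ attained x , attained y ]′ l≤
  ...   | z , refl = z , xl , ly

  positive⇒≢ : ∀ {x y k} → ∣ ℓ x - ℓ y ∣ ≡ suc k → x ≢ y
  positive⇒≢ {x} eq refl = contradiction (trans (sym (ℕ.∣n-n∣≡0 (ℓ x))) eq) λ ()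

  -- Distinct vertices of one level are adjacent, so they need one edge rather than none; hence the
  -- maximum with 1. If `k` is at least 2, the first edge goes one level closer to `y`.
  walk : ∀ k {x y} → x ≢ y → ∣ ℓ x - ℓ y ∣ ≡ k → Walk G x y (1 ⊔ k)
  walk 0             x≢y eq = (x≢y , ℕ.≤-trans (ℕ.≤-reflexive eq) z≤n) ∷ []
  walk 1             x≢y eq = (x≢y , ℕ.≤-reflexive eq) ∷ []
  walk (suc (suc k)) {x} {y} x≢y eq =
    let z , xz , zy = step x y eq in
    (positive⇒≢ xz , ℕ.≤-reflexive xz) ∷ walk (suc k) (positive⇒≢ zy) zy

  connected : Connected G
  connected x y with x ≟ y
  ... | yes refl = _ , []
  ... | no  x≢y  = _ , walk _ x≢y refl

  -- An edge changes the level by at most 1.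
  walk-≥ : ∀ {x y k} → Walk G x y k → ∣ ℓ x - ℓ y ∣ ≤ k
  walk-≥ {x} [] = ℕ.≤-reflexive (ℕ.∣n-n∣≡0 (ℓ x))
  walk-≥ {x} {y} (_∷_ {y = z} (_ , δ≤1) p) =
    ℕ.≤-trans (ℕ.∣-∣-triangle (ℓ x) (ℓ z) (ℓ y)) (ℕ.+-mono-≤ δ≤1 (walk-≥ p))

  dist : Fin n → Fin n → ℕ
  dist = d G connected

  dist-refl : ∀ x → dist x x ≡ 0
  dist-refl = d-refl G connected

  dist-≢ : ∀ {x y} → x ≢ y → dist x y ≡ 1 ⊔ ∣ ℓ x - ℓ y ∣
  dist-≢ {x} {y} x≢y = d-unique G connected
    (walk _ x≢y refl , λ _ p → ℕ.⊔-lub (nonempty p) (walk-≥ p))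
    where
    nonempty : ∀ {k} → Walk G x y k → 1 ≤ k
    nonempty []      = contradiction refl x≢y
    nonempty (_ ∷ _) = s≤s z≤n

  dist-ℓ≢ : ∀ {x y} → ℓ x ≢ ℓ y → dist x y ≡ ∣ ℓ x - ℓ y ∣
  dist-ℓ≢ {x} {y} ℓx≢ℓy = trans (dist-≢ (ℓx≢ℓy ∘ cong ℓ))
    (ℕ.m≤n⇒m⊔n≡n (ℕ.n≢0⇒n>0 (ℓx≢ℓy ∘ ℕ.∣m-n∣≡0⇒m≡n)))

  dist-twin : ∀ {x y z} → ℓ x ≡ ℓ y → z ≢ x → z ≢ y → dist x z ≡ dist y z
  dist-twin {z = z} ℓx≡ℓy z≢x z≢y = trans (dist-≢ (z≢x ∘ sym))
    (trans (cong (λ i → 1 ⊔ ∣ i - ℓ z ∣) ℓx≡ℓy) (sym (dist-≢ (z≢y ∘ sym))))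

-- The lollipop for a = 2 + m and b = a + k, with the clique on 0, …, m.
module Lollipop (m k : ℕ) where

  V : Set
  V = Fin (suc m + suc k)

  -- Truncation sends the vertices 0, ..., `m` to level 0; for positive `i`, only `m + i` has level
  -- `i`.
  ℓ : V → ℕ
  ℓ x = toℕ x ∸ m

  ℓ≤1+k : ∀ x → ℓ x ≤ suc k
  ℓ≤1+k x = ℕ.≤-trans (ℕ.∸-monoˡ-≤ m (toℕ≤pred[n] x)) (ℕ.≤-reflexive (ℕ.m+n∸m≡n m (suc k)))

  level : ∀ {i} → i ≤ suc k → ∃[ z ] ℓ z ≡ i
  level {i} i≤1+k = fromℕ< m+i<n ,
    trans (cong (_∸ m) (toℕ-fromℕ< m+i<n)) (ℕ.m+n∸m≡n m i)
    where
    m+i<n : m + i < suc m + suc k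
    m+i<n = s≤s (ℕ.+-monoʳ-≤ m i≤1+k)

  ℓ-injective : ∀ {x y} → ℓ x ≢ 0 → ℓ x ≡ ℓ y → x ≡ y
  ℓ-injective {x} {y} ℓx≢0 ℓx≡ℓy = toℕ-injective
    (ℕ.∸-cancelʳ-≡ (m≤ x ℓx≢0) (m≤ y (ℓx≢0 ∘ trans ℓx≡ℓy)) ℓx≡ℓy)
    where
    m≤ : ∀ z → ℓ z ≢ 0 → m ≤ toℕ z
    m≤ z ℓz≢0 = ℕ.<⇒≤ (ℕ.≰⇒> (ℓz≢0 ∘ ℕ.m≤n⇒m∸n≡0))

  open LevelGraph ℓ (λ x i≤ℓx → level (ℕ.≤-trans i≤ℓx (ℓ≤1+k x))) public

  clique : Subset (suc m + suc k)
  clique = initial (suc m) (suc k)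

  ∈clique : ∀ {x} → ℓ x ≡ 0 → x ∈ clique
  ∈clique ℓx≡0 = <⇒∈initial (suc m) (suc k) (s≤s (ℕ.m∸n≡0⇒m≤n ℓx≡0))

  ∈clique⇒ℓ≡0 : ∀ {x} → x ∈ clique → ℓ x ≡ 0
  ∈clique⇒ℓ≡0 x∈ = ℕ.m≤n⇒m∸n≡0 (s≤s⁻¹ (∈initial⇒< (suc m) (suc k) x∈))

  hub end : V
  hub = proj₁ (level (s≤s z≤n))
  end = proj₁ (level ℕ.≤-refl)

  ℓ-hub : ℓ hub ≡ 1
  ℓ-hub = proj₂ (level (s≤s z≤n))

  ℓ-end : ℓ end ≡ suc k
  ℓ-end = proj₂ (level ℕ.≤-refl)

  ℓ-zero : ℓ zero ≡ 0
  ℓ-zero = ℕ.0∸n≡0 m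

  ℓ-end≢0 : ℓ end ≢ 0
  ℓ-end≢0 eq = contradiction (trans (sym ℓ-end) eq) λ ()

  -- No other vertex shares the level of `end`, so the maximum with 1 drops out of the distance; at
  -- `end` itself both sides are 0.
  dist-end : ∀ x → dist x end ≡ suc k ∸ ℓ x
  dist-end x with ℓ x ℕ.≟ ℓ end
  ... | yes eq = trans
    (cong (λ y → dist y end) (sym (ℓ-injective ℓ-end≢0 (sym eq))))
    (trans (dist-refl end) (sym (ℕ.m≤n⇒m∸n≡0 (ℕ.≤-reflexive (sym (trans eq ℓ-end))))))
  ... | no ℓx≢ = trans (dist-ℓ≢ ℓx≢)
    (trans (cong (∣ ℓ x -_∣) ℓ-end) (ℕ.m≤n⇒∣m-n∣≡n∸m (ℓ≤1+k x)))

  dist-end-injective : ∀ {x y} → dist x end ≡ dist y end → ℓ x ≡ ℓ y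
  dist-end-injective {x} {y} eq = ℕ.∸-cancelˡ-≡ (ℓ≤1+k x) (ℓ≤1+k y)
    (trans (sym (dist-end x)) (trans eq (dist-end y)))

  -- Upper bound: a WTR-set of cardinality `2 + m`.

  W₀ : Subset (suc m + suc k)
  W₀ = clique ∪ ⁅ end ⁆

  end∈W₀ : end ∈ W₀
  end∈W₀ = q⊆p∪q clique ⁅ end ⁆ (x∈⁅x⁆ end)

  ∉W₀⇒ℓ≢0 : ∀ {x} → x ∉ W₀ → ℓ x ≢ 0
  ∉W₀⇒ℓ≢0 x∉ = x∉ ∘ p⊆p∪q ⁅ end ⁆ ∘ ∈clique

  ∣W₀∣≤2+m : ∣ W₀ ∣ ≤ suc (suc m)
  ∣W₀∣≤2+m = ℕ.≤-trans (∣p∪q∣≤∣p∣+∣q∣ clique ⁅ end ⁆) (ℕ.≤-reflexive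
    (trans (cong₂ _+_ (∣initial∣ (suc m) (suc k)) (∣⁅x⁆∣≡1 end)) (ℕ.+-comm (suc m) 1)))

  W₀-weakTotalResolving : WeakTotalResolving G connected W₀
  W₀-weakTotalResolving = resolving , total
    where
    resolving : Resolving G connected W₀
    resolving y z y≢z = case y ∈? W₀ of λ where
      (yes y∈) → y , y∈ , λ eq →
        y≢z (sym (d≡0⇒≡ G connected (trans (sym eq) (dist-refl y))))
      -- Outside `W₀` the level of `y` is positive, so it determines `y`; and the distance to `end`
      -- determines the level.
      (no y∉) → end , end∈W₀ , y≢z ∘ ℓ-injective (∉W₀⇒ℓ≢0 y∉) ∘ dist-end-injective

    dist-zero : ∀ {y} → ℓ y ≢ 0 → dist y zero ≡ ℓ y
    dist-zero {y} ℓy≢0 = trans (dist-ℓ≢ (λ eq → ℓy≢0 (trans eq ℓ-zero)))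
      (trans (cong (∣ ℓ y -_∣) ℓ-zero) (ℕ.∣-∣-identityʳ (ℓ y)))

    total : ∀ w x → w ∈ W₀ → x ∉ W₀ → ∃[ w′ ] (w′ ∈ W₀ × w′ ≢ w × dist x w′ ≢ dist w w′)
    total w x w∈ x∉ = case end ≟ w of λ where
        (no end≢w) → end , end∈W₀ , end≢w ,
          x≢w ∘ ℓ-injective ℓx≢0 ∘ dist-end-injective
        -- Here `end` is `w` itself and may not be used. Both `x` and `w` have positive levels,
        -- which are their distances to the clique vertex `zero`.
        (yes end≡w) →
          let ℓw≢0 = subst (λ v → ℓ v ≢ 0) end≡w ℓ-end≢0 in
          zero , p⊆p∪q ⁅ end ⁆ here ,
          (λ zero≡w → ℓw≢0 (trans (cong ℓ (sym zero≡w)) ℓ-zero)) ,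
          λ eq → x≢w (ℓ-injective ℓx≢0
            (trans (sym (dist-zero ℓx≢0)) (trans eq (dist-zero ℓw≢0))))
      where
      ℓx≢0 : ℓ x ≢ 0
      ℓx≢0 = ∉W₀⇒ℓ≢0 x∉

      x≢w : x ≢ w
      x≢w = ∈∧∉⇒≢ w∈ x∉ ∘ sym

  -- Lower bound for an arbitrary WTR-set.

  module _ {W : Subset (suc m + suc k)} (wtr : WeakTotalResolving G connected W) where

    -- If `u` and `v` were distinct, they would be twins, separated only by `u` or `v`. Resolving
    -- them would then force `u` into `W`, while separating `u` from the omitted `v` by a third
    -- vertex rules that out.
    omitted⇒only-clique-vertex : ∀ {u v} → v ∉ W → ℓ v ≡ 0 → ℓ u ≡ 0 → u ≡ v
    omitted⇒only-clique-vertex {u} {v} v∉ ℓv ℓu =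
      decidable-stable (u ≟ v) λ u≢v → u∉ (u∈ u≢v)
      where
      u∉ : u ∉ W
      u∉ u∈ =
        let w , w∈ , w≢u , sep = proj₂ wtr u v u∈ v∉ in
        sep (dist-twin {v} {u} {w} (trans ℓv (sym ℓu)) (∈∧∉⇒≢ w∈ v∉) w≢u)

      u∈ : u ≢ v → u ∈ W
      u∈ u≢v =
        let w , w∈ , sep = proj₁ wtr u v u≢v in
        contradiction
          (dist-twin {u} {v} {w} (trans ℓu (sym ℓv)) (∈∧∉⇒≢ w∈ u∉) (∈∧∉⇒≢ w∈ v∉)) sep

    path-vertex : clique ⊆ W → ∃[ j ] (j ∈ W × ℓ j ≢ 0)
    path-vertex clique⊆W = case hub ∈? W of λ where
        (yes hub∈) → hub , hub∈ , λ eq → contradiction (trans (sym ℓ-hub) eq) λ ()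
        (no  hub∉) →
          -- A clique vertex `j` other than `zero` would be at distance 1 from both `zero` and
          -- `hub`.
          let j , j∈ , j≢0 , sep = proj₂ wtr zero hub (clique⊆W here) hub∉ in
          j , j∈ , λ ℓj → sep (trans
            (dist≡1 ℓj (∈∧∉⇒≢ j∈ hub∉ ∘ sym) (ℕ.≤-reflexive ℓ-hub))
            (sym (dist≡1 ℓj (j≢0 ∘ sym) (ℕ.≤-trans (ℕ.≤-reflexive ℓ-zero) z≤n))))
      where
      dist≡1 : ∀ {x y} → ℓ y ≡ 0 → x ≢ y → ℓ x ≤ 1 → dist x y ≡ 1
      dist≡1 {x} ℓy≡0 x≢y ℓx≤1 = trans (dist-≢ x≢y) (ℕ.m≥n⇒m⊔n≡m (subst (_≤ 1)
        (sym (trans (cong (∣ ℓ x -_∣) ℓy≡0) (ℕ.∣-∣-identityʳ (ℓ x)))) ℓx≤1))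

    two-elements : ∀ {v} → v ∉ W → ∃[ w ] ∃[ w′ ] (w ∈ W × w′ ∈ W × w ≢ w′)
    two-elements {v} v∉ =
      -- Any two distinct vertices would do here, since resolving them only serves to show that `W`
      -- is inhabited.
      let w  , w∈  , _        = proj₁ wtr zero end zero≢end
          w′ , w′∈ , w′≢w , _ = proj₂ wtr w v w∈ v∉
      in w , w′ , w∈ , w′∈ , w′≢w ∘ sym
      where
      zero≢end : zero ≢ end
      zero≢end eq = ℓ-end≢0 (trans (cong ℓ (sym eq)) ℓ-zero)

    clique⊆W⇒∣clique∣<∣W∣ : clique ⊆ W → ∣ clique ∣ < ∣ W ∣
    clique⊆W⇒∣clique∣<∣W∣ clique⊆W =
      let j , j∈ , ℓj≢0 = path-vertex clique⊆W in
      p⊂q⇒∣p∣<∣q∣ (clique⊆W , j , j∈ , ℓj≢0 ∘ ∈clique⇒ℓ≡0)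

    omitted⇒∣clique∣<∣W∣ : ∀ {v} → v ∉ W → ℓ v ≡ 0 → ∣ clique ∣ < ∣ W ∣
    omitted⇒∣clique∣<∣W∣ {v} v∉ ℓv = ℕ.≤-<-trans ∣clique∣≤1 1<∣W∣
      where
      ∣clique∣≤1 : ∣ clique ∣ ≤ 1
      ∣clique∣≤1 = subst (∣ clique ∣ ≤_) (∣⁅x⁆∣≡1 v) (p⊆q⇒∣p∣≤∣q∣ λ u∈ →
        subst (_∈ ⁅ v ⁆) (sym (omitted⇒only-clique-vertex v∉ ℓv (∈clique⇒ℓ≡0 u∈))) (x∈⁅x⁆ v))

      1<∣W∣ : 1 < ∣ W ∣
      1<∣W∣ =
        let w , w′ , w∈ , w′∈ , w≢w′ = two-elements v∉ in
        subst (_< ∣ W ∣) (∣⁅x⁆∣≡1 w) (p⊂q⇒∣p∣<∣q∣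
          ( (λ u∈ → subst (_∈ W) (sym (x∈⁅y⁆⇒x≡y w u∈)) w∈)
          , w′ , w′∈ , w≢w′ ∘ sym ∘ x∈⁅y⁆⇒x≡y w))

    ∣clique∣<∣W∣ : ∣ clique ∣ < ∣ W ∣
    ∣clique∣<∣W∣ = case all? ℓ≡0→∈W? of λ where
        (yes ⊆W) → clique⊆W⇒∣clique∣<∣W∣ λ {v} → ⊆W v ∘ ∈clique⇒ℓ≡0
        (no  ⊈W) →
          let v , ¬v = ¬∀⟶∃¬ _ _ ℓ≡0→∈W? ⊈W in
          omitted⇒∣clique∣<∣W∣ {v} (λ v∈ → ¬v (λ _ → v∈))
            (decidable-stable (ℓ v ℕ.≟ 0) (λ ℓv≢0 → ¬v (λ ℓv → contradiction ℓv ℓv≢0)))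
      where
      ℓ≡0→∈W? : Decidable (λ v → ℓ v ≡ 0 → v ∈ W)
      ℓ≡0→∈W? v = (ℓ v ℕ.≟ 0) →-dec (v ∈? W)

  2+m≤∣W∣ : ∀ W → WeakTotalResolving G connected W → suc (suc m) ≤ ∣ W ∣
  2+m≤∣W∣ W wtr = subst (_< ∣ W ∣) (∣initial∣ (suc m) (suc k)) (∣clique∣<∣W∣ {W} wtr)

  2+m-least : IsLeast (WTRCardinality G connected) (suc (suc m))
  2+m-least =
    -- The lower bound applied to `W₀` itself turns the estimate of its cardinality into an
    -- equality.
    (W₀ , W₀-weakTotalResolving , ℕ.≤-antisym ∣W₀∣≤2+m (2+m≤∣W∣ W₀ W₀-weakTotalResolving)) ,
    λ l (W , wtr , ∣W∣≡l) → subst (suc (suc m) ≤_) ∣W∣≡l (2+m≤∣W∣ W wtr)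

theorem13 : (a b : ℕ) → 2 ≤ a → a ≤ b →
    Σ[ G ∈ SimpleGraph b ] Σ[ conn ∈ Connected G ] dim-wt G conn ≡ a
theorem13 (suc (suc m)) b (s≤s (s≤s z≤n)) a≤b =
  let k , 2+m+k≡b = ℕ.m≤n⇒∃[o]m+o≡n a≤b in
  least⇒dim-wt (subst
    (λ n → Σ[ G ∈ SimpleGraph n ] Σ[ conn ∈ Connected G ]
             IsLeast (WTRCardinality G conn) (suc (suc m)))
    -- The lollipop has order `suc m + suc k`, whereas `b` is given as `suc (suc m) + k`.
    (trans (ℕ.+-suc (suc m) k) 2+m+k≡b)
    (Lollipop.G m k , Lollipop.connected m k , Lollipop.2+m-least m k))
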